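{- Fix an $\mathbf{FO}^2$ sentence $\Gamma$ in Scott normal form and a finite domain $\Delta=\{e_1,\dots,e_n\}$, $n\ge 1$. Let $\Phi_{\Gamma,\Delta}$ be the propositional grounding of $(\Gamma,\Delta)$. Then the Two-Stage Compilation algorithm (described in the context), run on $\Gamma$ and $\Delta$, outputs a d-DNNF circuit that encodes $\Phi_{\Gamma,\Delta}$.
   Context: Logic. First-order logic is function-free, constant-free and without equality. Vocabularies are finite, with predicates of arity 1 or 2, and domains are finite and non-empty. A sentence $\Gamma$ is in Scott normal form if $\Gamma=\forall x\forall y:\phi(x,y)\wedge\bigwedge_{k\in[m]}\forall x\exists y:\beta_k(x,y)$, where $\phi$ is quantifier-free with variables among $x,y$ and each $\beta_k(x,y)$ is a single binary atom. The grounding of $(\Gamma,\Delta)$ is the propositional formula obtained by instantiating all quantifiers over $\Delta$; its variables are the ground atoms over $\Delta$. Circuits. An NNF circuit is a labelled DAG with internal nodes $\wedge,\vee$, leaves that are literals (or the constants $\top,\bot$), and a unique output node. $\mathrm{var}(C)$ is the set of variables of $C$. It is decomposable if the children of each $\wedge$-node have pairwise disjoint variable sets. It is deterministic if the children of each $\vee$-node are pairwise inconsistent. A d-DNNF is a decomposable and deterministic NNF. A circuit encodes a formula if they have the same satisfying assignments. Types. A unary type $\tau$ is a maximally consistent set of literals over the atoms $P(x)$ ($P$ unary in $\Gamma$) and $R(x,x)$ ($R$ binary in $\Gamma$). A binary type $\pi$ is a maximally consistent set of literals over the atoms $R(x,y),R(y,x)$ ($R$ binary in $\Gamma$). Types are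 identified with the conjunctions $\tau(x)$, $\pi(x,y)$ of their literals. $\tau$ is valid if $\tau(x)\models\phi(x,x)$; $\mathcal U$ is the set of valid unary types. For $\tau,\tau'\in\mathcal U$, $\mathcal B(\tau,\tau')$ is the set of binary types $\pi$ with $\tau(x)\wedge\tau'(y)\wedge\pi(x,y)\models\phi(x,y)\wedge\phi(y,x)$. Algorithm. A context $\theta$ is the conjunction of the ground type formulas chosen so far along the current recursion branch. $\textsc{Extendable}(\theta)$ holds iff there is a model $\mathcal A$ over $\Delta$ with $\mathcal A\models\Gamma\wedge\theta$. $\textsc{Or}(S)$ and $\textsc{And}(S)$ create an $\vee$-node (resp. $\wedge$-node) with children $S$; empty $\textsc{Or}$ is $\bot$ and empty $\textsc{And}$ is $\top$. Two-Stage Compilation returns $\textsc{Stage-I}(1,\top)$, where: - $\textsc{Stage-I}(i,\theta)$: if $i=n+1$, return $\textsc{Stage-II}((1,2),\theta)$. Otherwise return $\textsc{Or}$ of the set of all nodes $\textsc{And}(\textsc{And}(\tau(e_i)),\textsc{Stage-I}(i+1,\theta\wedge\tau(e_i)))$, over all $\tau\in\mathcal U$ for which $\textsc{Extendable}(\theta\wedge\tau(e_i))$ holds, where $\textsc{And}(\tau(e_i))$ is the $\wedge$-node over the literals of $\tau(e_i)$. - $\textsc{Stage-II}((i,j),\theta)$: if $i=n$, return $\top$. Otherwise let $\tau_i,\tau_j$ be the unary types assigned to $e_i,e_j$ in $\theta$ and return $\textsc{Or}$ of the set of all nodes $\textsc{And}(\textsc{And}(\pi(e_i,e_j)),\textsc{Stage-II}(\mathrm{next}(i,j),\theta\wedge\pi(e_i,e_j)))$,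 over all $\pi\in\mathcal B(\tau_i,\tau_j)$ for which $\textsc{Extendable}(\theta\wedge\pi(e_i,e_j))$ holds. Here $\mathrm{next}(i,j)$ is the next pair in lexicographic order among pairs with $1\le i<j\le n$, i.e. $(i,j+1)$ if $j<n$ and $(i+1,i+2)$ if $j=n$ (so the pair $(n-1,n)$ is followed by a terminal call with first index $n$). -}

module Defs where

open import Data.Bool.Base using (Bool; true; false; T; not; _∧_; _∨_; if_then_else_)
open import Data.Bool.Properties using (T?)
open import Data.Fin.Base using (Fin; zero; suc; _↑ˡ_; _↑ʳ_; combine; remQuot; splitAt)
open import Data.Fin.Properties using (_≟_; _<?_; all?; any?; remQuot-combine; splitAt-↑ˡ; splitAt-↑ʳ)
open import Data.Fin.Subset using (Subset)
open import Data.Fin.Subset.Properties using (anySubset?)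
open import Data.List.Base using (List; []; _∷_; [_]; _++_; map; foldr; allFin; filter; cartesianProduct; cartesianProductWith)
open import Data.List.Membership.Propositional using (_∈_)
open import Data.List.Relation.Unary.All using (All)
open import Data.List.Relation.Unary.Any using (Any)
open import Data.List.Relation.Unary.AllPairs using (AllPairs)
open import Data.Maybe.Base using (Maybe; just; nothing; zipWith; fromMaybe)
open import Data.Nat.Base using (ℕ; zero; suc; _+_; _*_)
open import Data.Product.Base using (∃; _×_; _,_; uncurry)
open import Data.Sum.Base using ([_,_]′)
open import Data.Vec.Base using (Vec; []; _∷_; lookup; tabulate)
open import Data.Vec.Properties using (lookup∘tabulate)
open import Function.Base using (_∘_)
open import Function.Bundles using (_⇔_)
open import Relation.Binary.Construct.Closure.ReflexiveTransitive using (Star)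
open import Relation.Binary.PropositionalEquality using (_≡_; _≗_; refl; sym; trans; cong; cong₂; subst)
open import Relation.Nullary.Decidable using (Dec; does; map′; _×-dec_; ¬?; decidable-stable)
open import Relation.Nullary.Negation using (¬_)

infix  8 ¬ᶠ_
infixr 7 _∧ᶠ_
infixr 6 _∨ᶠ_

data Formula (A : Set) : Set where
  atom      : A → Formula A
  ⊤ᶠ ⊥ᶠ     : Formula A
  ¬ᶠ_       : Formula A → Formula A
  _∧ᶠ_ _∨ᶠ_ : Formula A → Formula A → Formula A

mapᶠ : {A B : Set} → (A → B) → Formula A → Formula B
mapᶠ f (atom a) = atom (f a)
mapᶠ f ⊤ᶠ       = ⊤ᶠ
mapᶠ f ⊥ᶠ       = ⊥ᶠ
mapᶠ f (¬ᶠ F)   = ¬ᶠ mapᶠ f F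
mapᶠ f (F ∧ᶠ G) = mapᶠ f F ∧ᶠ mapᶠ f G
mapᶠ f (F ∨ᶠ G) = mapᶠ f F ∨ᶠ mapᶠ f G

⋀ᶠ ⋁ᶠ : {A : Set} → List (Formula A) → Formula A
⋀ᶠ = foldr _∧ᶠ_ ⊤ᶠ
⋁ᶠ = foldr _∨ᶠ_ ⊥ᶠ

Assignment : Set → Set
Assignment A = A → Bool

eval : {A : Set} → Assignment A → Formula A → Bool
eval v (atom a) = v a
eval v ⊤ᶠ       = true
eval v ⊥ᶠ       = false
eval v (¬ᶠ F)   = not (eval v F)
eval v (F ∧ᶠ G) = eval v F ∧ eval v G
eval v (F ∨ᶠ G) = eval v F ∨ eval v G

infix 4 _⊨_

_⊨_ : {A : Set} → Assignment A → Formula A → Set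
v ⊨ F = T (eval v F)

eval-cong : {A : Set} {v w : Assignment A} → v ≗ w → eval v ≗ eval w
eval-cong v≗w (atom a) = v≗w a
eval-cong v≗w ⊤ᶠ       = refl
eval-cong v≗w ⊥ᶠ       = refl
eval-cong v≗w (¬ᶠ F)   = cong not (eval-cong v≗w F)
eval-cong v≗w (F ∧ᶠ G) = cong₂ _∧_ (eval-cong v≗w F) (eval-cong v≗w G)
eval-cong v≗w (F ∨ᶠ G) = cong₂ _∨_ (eval-cong v≗w F) (eval-cong v≗w G)

⊨-resp : {A : Set} {v w : Assignment A} (F : Formula A) → v ≗ w → v ⊨ F → w ⊨ F
⊨-resp F v≗w = subst T (eval-cong v≗w F)

eval-map : {A B : Set} {f : A → B} {v : Assignment B} {w : Assignment A} →
           v ∘ f ≗ w → eval v ∘ mapᶠ f ≗ eval w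
eval-map eq (atom a) = eq a
eval-map eq ⊤ᶠ       = refl
eval-map eq ⊥ᶠ       = refl
eval-map eq (¬ᶠ F)   = cong not (eval-map eq F)
eval-map eq (F ∧ᶠ G) = cong₂ _∧_ (eval-map eq F) (eval-map eq G)
eval-map eq (F ∨ᶠ G) = cong₂ _∨_ (eval-map eq F) (eval-map eq G)

data Literal (A : Set) : Set where
  pos neg : A → Literal A

variableOf : {A : Set} → Literal A → A
variableOf (pos a) = a
variableOf (neg a) = a

literalᶠ : {A : Set} → Literal A → Formula A
literalᶠ (pos a) = atom a
literalᶠ (neg a) = ¬ᶠ atom a

signed : {A : Set} → Bool → A → Literal A
signed b a = if b then pos a else neg a

-- A node is given together with everything reachable from it, and a circuit
-- by its output node.  The nodes of the circuit C are the D with D ≼ C: they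
-- form a DAG under Child, in which equal subcircuits are the same node.

data NNF (A : Set) : Set where
  lit   : Literal A → NNF A
  ⊤ᶜ ⊥ᶜ : NNF A
  ⋀ ⋁   : List (NNF A) → NNF A

children : {A : Set} → NNF A → List (NNF A)
children (⋀ S) = S
children (⋁ S) = S
children _     = []

Child : {A : Set} → NNF A → NNF A → Set
Child D C = D ∈ children C

infix 4 _≼_ _∈var_ _⊨ᶜ_

_≼_ : {A : Set} → NNF A → NNF A → Set
_≼_ = Star Child

data _∈var_ {A : Set} (a : A) : NNF A → Set where
  lit : ∀ {l} → variableOf l ≡ a → a ∈var lit l
  ⋀   : ∀ {S} → Any (a ∈var_) S → a ∈var ⋀ S
  ⋁   : ∀ {S} → Any (a ∈var_) S → a ∈var ⋁ S

data _⊨ᶜ_ {A : Set} (v : Assignment A) : NNF A → Set where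
  lit : ∀ {l} → v ⊨ literalᶠ l → v ⊨ᶜ lit l
  ⊤ᶜ  : v ⊨ᶜ ⊤ᶜ
  ⋀   : ∀ {S} → All (v ⊨ᶜ_) S → v ⊨ᶜ ⋀ S
  ⋁   : ∀ {S} → Any (v ⊨ᶜ_) S → v ⊨ᶜ ⋁ S

DisjointVars : {A : Set} → NNF A → NNF A → Set
DisjointVars C D = ∀ a → ¬ (a ∈var C × a ∈var D)

Inconsistent : {A : Set} → NNF A → NNF A → Set
Inconsistent C D = ∀ v → ¬ (v ⊨ᶜ C × v ⊨ᶜ D)

Decomposable : {A : Set} → NNF A → Set
Decomposable C = ∀ S → ⋀ S ≼ C → AllPairs DisjointVars S

Deterministic : {A : Set} → NNF A → Set
Deterministic C = ∀ S → ⋁ S ≼ C → AllPairs Inconsistent S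

IsDDNNF : {A : Set} → NNF A → Set
IsDDNNF C = Decomposable C × Deterministic C

infix 4 _Encodes_

_Encodes_ : {A : Set} → NNF A → Formula A → Set
C Encodes F = ∀ v → v ⊨ᶜ C ⇔ v ⊨ F

And Or : {A : Set} → List (NNF A) → NNF A
And []        = ⊤ᶜ
And S@(_ ∷ _) = ⋀ S
Or  []        = ⊥ᶜ
Or  S@(_ ∷ _) = ⋁ S

record Vocabulary : Set where
  field
    #unary #binary : ℕ

open Vocabulary

-- Atoms over the terms T, which are variables or domain elements.

data Atom (𝒱 : Vocabulary) (T : Set) : Set where
  unary  : Fin (#unary 𝒱) → T → Atom 𝒱 T
  binary : Fin (#binary 𝒱) → T → T → Atom 𝒱 T

mapᵃ : {𝒱 : Vocabulary} {T U : Set} → (T → U) → Atom 𝒱 T → Atom 𝒱 U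
mapᵃ f (unary P t)    = unary P (f t)
mapᵃ f (binary R s t) = binary R (f s) (f t)

Var : Set
Var = Fin 2

pattern 𝐱 = zero
pattern 𝐲 = suc zero

assign : {T : Set} → T → T → Var → T
assign s t 𝐱 = s
assign s t 𝐲 = t

QF : Vocabulary → Set
QF 𝒱 = Formula (Atom 𝒱 Var)

infix 9 _⟨_,_⟩

_⟨_,_⟩ : {𝒱 : Vocabulary} {T : Set} → QF 𝒱 → T → T → Formula (Atom 𝒱 T)
F ⟨ s , t ⟩ = mapᶠ (mapᵃ (assign s t)) F

-- ∀x∀y φ ∧ ⋀ₖ ∀x∃y βₖ, where βₖ is the atom R(s,t) for βPred k = R and
-- βArgs k = (s , t).

record ScottNormalForm (𝒱 : Vocabulary) : Set where
  field
    φ     : QF 𝒱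
    m     : ℕ
    βPred : Fin m → Fin (#binary 𝒱)
    βArgs : Fin m → Var × Var

  β : Fin m → QF 𝒱
  β k = atom (uncurry (binary (βPred k)) (βArgs k))

GroundAtom : Vocabulary → ℕ → Set
GroundAtom 𝒱 n = Atom 𝒱 (Fin n)

-- A structure over Fin n is the assignment telling which ground atoms hold.

Structure : Vocabulary → ℕ → Set
Structure 𝒱 n = Assignment (GroundAtom 𝒱 n)

module _ {𝒱 : Vocabulary} where

  infix 4 _⊨ₛ_ _⊨ₛ?_ _⊫_ _⊫?_

  _⊨ₛ_ : {n : ℕ} → Structure 𝒱 n → ScottNormalForm 𝒱 → Set
  𝒜 ⊨ₛ Γ = (∀ a b → 𝒜 ⊨ φ ⟨ a , b ⟩)
         × (∀ k a → ∃ λ b → 𝒜 ⊨ β k ⟨ a , b ⟩)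
    where open ScottNormalForm Γ

  grounding : ScottNormalForm 𝒱 → (n : ℕ) → Formula (GroundAtom 𝒱 n)
  grounding Γ n =
       (⋀ᶠ (map (λ a → ⋀ᶠ (map (λ b → φ ⟨ a , b ⟩) (allFin n))) (allFin n)))
    ∧ᶠ (⋀ᶠ (map (λ k → ⋀ᶠ (map (λ a → ⋁ᶠ (map (λ b → β k ⟨ a , b ⟩)
                                              (allFin n)))
                               (allFin n)))
                (allFin m)))
    where open ScottNormalForm Γ

  _⊫_ : QF 𝒱 → QF 𝒱 → Set
  F ⊫ G = ∀ n (𝒜 : Structure 𝒱 n) (a b : Fin n) → 𝒜 ⊨ F ⟨ a , b ⟩ → 𝒜 ⊨ G ⟨ a , b ⟩

  private
    size : ℕ → ℕ
    size n = #unary 𝒱 * n + #binary 𝒱 * (n * n)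

    index : {n : ℕ} → GroundAtom 𝒱 n → Fin (size n)
    index {n} (unary P a)    = combine P a ↑ˡ (#binary 𝒱 * (n * n))
    index {n} (binary R a b) = (#unary 𝒱 * n) ↑ʳ combine R (combine a b)

    binaryAtomAt : (n : ℕ) → Fin (#binary 𝒱) × Fin (n * n) → GroundAtom 𝒱 n
    binaryAtomAt n (R , ab) = uncurry (binary R) (remQuot n ab)

    atomAt : (n : ℕ) → Fin (size n) → GroundAtom 𝒱 n
    atomAt n i = [ uncurry unary ∘ remQuot n , binaryAtomAt n ∘ remQuot (n * n) ]′
                 (splitAt (#unary 𝒱 * n) i)

    atomAt-index : {n : ℕ} (α : GroundAtom 𝒱 n) → atomAt n (index α) ≡ α
    atomAt-index {n} (unary P a)
      rewrite splitAt-↑ˡ (#unary 𝒱 * n) (combine P a) (#binary 𝒱 * (n * n)) =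
      cong (uncurry unary) (remQuot-combine P a)
    atomAt-index {n} (binary R a b)
      rewrite splitAt-↑ʳ (#unary 𝒱 * n) (#binary 𝒱 * (n * n)) (combine R (combine a b)) =
      trans (cong (binaryAtomAt n) (remQuot-combine R (combine a b)))
            (cong (uncurry (binary R)) (remQuot-combine a b))

  anyStructure? : {n : ℕ} {P : Structure 𝒱 n → Set} →
                  (∀ {v w} → v ≗ w → P v → P w) → (∀ v → Dec (P v)) → Dec (∃ P)
  anyStructure? {n} resp P? =
    map′ (λ (s , p) → lookup s ∘ index , p)
         (λ (v , p) → tabulate (v ∘ atomAt n)
                    , resp (λ α → sym (trans (lookup∘tabulate (v ∘ atomAt n) (index α))
                                             (cong v (atomAt-index α)))) p)
         (anySubset? (λ s → P? (lookup s ∘ index)))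

  ⊨ₛ-resp : {n : ℕ} {v w : Structure 𝒱 n} (Γ : ScottNormalForm 𝒱) → v ≗ w → v ⊨ₛ Γ → w ⊨ₛ Γ
  ⊨ₛ-resp Γ v≗w (p , q) =
    (λ a b → ⊨-resp (φ ⟨ a , b ⟩) v≗w (p a b)) ,
    (λ k a → let b , r = q k a in b , ⊨-resp (β k ⟨ a , b ⟩) v≗w r)
    where open ScottNormalForm Γ

  _⊨ₛ?_ : {n : ℕ} (𝒜 : Structure 𝒱 n) (Γ : ScottNormalForm 𝒱) → Dec (𝒜 ⊨ₛ Γ)
  𝒜 ⊨ₛ? Γ = all? (λ a → all? (λ b → T? _))
      ×-dec all? (λ k → all? (λ a → any? (λ b → T? (eval 𝒜 (β k ⟨ a , b ⟩)))))
    where open ScottNormalForm Γ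

  -- Consequence between quantifier-free formulas is decided on the structures
  -- with domain Var, where each variable denotes itself.
  _⊫?_ : (F G : QF 𝒱) → Dec (F ⊫ G)
  F ⊫? G = map′ to from (¬? (anyStructure? resp (λ v → T? (eval v F) ×-dec ¬? (T? (eval v G)))))
    where
    Countermodel : Structure 𝒱 2 → Set
    Countermodel v = v ⊨ F × ¬ v ⊨ G

    resp : ∀ {v w} → v ≗ w → Countermodel v → Countermodel w
    resp v≗w (p , q) = ⊨-resp F v≗w p , q ∘ ⊨-resp G (sym ∘ v≗w)

    to : ¬ ∃ Countermodel → F ⊫ G
    to none n 𝒜 a b p = decidable-stable (T? _) λ q →
      none (𝒜 ∘ mapᵃ (assign a b) , subst T (eval-map (λ _ → refl) F) p
                       , q ∘ subst T (sym (eval-map (λ _ → refl) G)))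

    assign-η : (t : Var) → assign 𝐱 𝐲 t ≡ t
    assign-η 𝐱 = refl
    assign-η 𝐲 = refl

    identity : (v : Structure 𝒱 2) → v ∘ mapᵃ (assign 𝐱 𝐲) ≗ v
    identity v (unary P t)    = cong (v ∘ unary P) (assign-η t)
    identity v (binary R s t) = cong v (cong₂ (binary R) (assign-η s) (assign-η t))

    from : F ⊫ G → ¬ ∃ Countermodel
    from F⊫G (v , p , q) =
      q (subst T (eval-map (identity v) G)
          (F⊫G 2 v 𝐱 𝐲 (subst T (sym (eval-map (identity v) F)) p)))

-- A maximally consistent set of literals over a finite set of atoms is given
-- by the sign of each atom: of the P(x) and R(x,x) for a unary type, of the
-- R(x,y) and R(y,x) for a binary type.

record UnaryType (𝒱 : Vocabulary) : Set where
  constructor mkUnary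
  field
    signP : Vec Bool (#unary 𝒱)
    signR : Vec Bool (#binary 𝒱)

record BinaryType (𝒱 : Vocabulary) : Set where
  constructor mkBinary
  field
    forward  : Vec Bool (#binary 𝒱)
    backward : Vec Bool (#binary 𝒱)

allSigns : (k : ℕ) → List (Vec Bool k)
allSigns zero    = [ [] ]
allSigns (suc k) = cartesianProductWith _∷_ (true ∷ false ∷ []) (allSigns k)

module _ {𝒱 : Vocabulary} where

  allUnaryTypes : List (UnaryType 𝒱)
  allUnaryTypes = cartesianProductWith mkUnary (allSigns (#unary 𝒱)) (allSigns (#binary 𝒱))

  allBinaryTypes : List (BinaryType 𝒱)
  allBinaryTypes = cartesianProductWith mkBinary (allSigns (#binary 𝒱)) (allSigns (#binary 𝒱))

  unaryLiterals : {T : Set} → UnaryType 𝒱 → T → List (Literal (Atom 𝒱 T))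
  unaryLiterals (mkUnary p r) t =
       map (λ P → signed (lookup p P) (unary P t))    (allFin (#unary 𝒱))
    ++ map (λ R → signed (lookup r R) (binary R t t)) (allFin (#binary 𝒱))

  binaryLiterals : {T : Set} → BinaryType 𝒱 → T → T → List (Literal (Atom 𝒱 T))
  binaryLiterals (mkBinary f b) s t =
       map (λ R → signed (lookup f R) (binary R s t)) (allFin (#binary 𝒱))
    ++ map (λ R → signed (lookup b R) (binary R t s)) (allFin (#binary 𝒱))

  unaryᶠ : {T : Set} → UnaryType 𝒱 → T → Formula (Atom 𝒱 T)
  unaryᶠ τ t = ⋀ᶠ (map literalᶠ (unaryLiterals τ t))

  binaryᶠ : {T : Set} → BinaryType 𝒱 → T → T → Formula (Atom 𝒱 T)
  binaryᶠ π s t = ⋀ᶠ (map literalᶠ (binaryLiterals π s t))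

module _ {𝒱 : Vocabulary} (Γ : ScottNormalForm 𝒱) where

  open ScottNormalForm Γ

  Valid : UnaryType 𝒱 → Set
  Valid τ = unaryᶠ τ 𝐱 ⊫ φ ⟨ 𝐱 , 𝐱 ⟩

  Compatible : UnaryType 𝒱 → UnaryType 𝒱 → BinaryType 𝒱 → Set
  Compatible τ τ′ π =
    (unaryᶠ τ 𝐱 ∧ᶠ unaryᶠ τ′ 𝐲 ∧ᶠ binaryᶠ π 𝐱 𝐲) ⊫ (φ ⟨ 𝐱 , 𝐲 ⟩ ∧ᶠ φ ⟨ 𝐲 , 𝐱 ⟩)

  valid? : ∀ τ → Dec (Valid τ)
  valid? τ = unaryᶠ τ 𝐱 ⊫? φ ⟨ 𝐱 , 𝐱 ⟩

  compatible? : ∀ τ τ′ π → Dec (Compatible τ τ′ π)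
  compatible? τ τ′ π =
    (unaryᶠ τ 𝐱 ∧ᶠ unaryᶠ τ′ 𝐲 ∧ᶠ binaryᶠ π 𝐱 𝐲) ⊫? (φ ⟨ 𝐱 , 𝐲 ⟩ ∧ᶠ φ ⟨ 𝐲 , 𝐱 ⟩)

  𝒰 : List (UnaryType 𝒱)
  𝒰 = filter valid? allUnaryTypes

  ℬ : UnaryType 𝒱 → UnaryType 𝒱 → List (BinaryType 𝒱)
  ℬ τ τ′ = filter (compatible? τ τ′) allBinaryTypes

  module _ (n : ℕ) where

    private
      Δ : Set
      Δ = Fin n

    data GroundType : Set where
      unaryAt  : UnaryType 𝒱 → Δ → GroundType
      binaryAt : BinaryType 𝒱 → Δ → Δ → GroundType

    groundLiterals : GroundType → List (Literal (GroundAtom 𝒱 n))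
    groundLiterals (unaryAt τ e)     = unaryLiterals τ e
    groundLiterals (binaryAt π e e′) = binaryLiterals π e e′

    groundTypeᶠ : GroundType → Formula (GroundAtom 𝒱 n)
    groundTypeᶠ (unaryAt τ e)     = unaryᶠ τ e
    groundTypeᶠ (binaryAt π e e′) = binaryᶠ π e e′

    -- The conjuncts of θ, the most recent first.
    Context : Set
    Context = List GroundType

    contextᶠ : Context → Formula (GroundAtom 𝒱 n)
    contextᶠ θ = ⋀ᶠ (map groundTypeᶠ θ)

    typeIn : Context → Δ → Maybe (UnaryType 𝒱)
    typeIn []                   e = nothing
    typeIn (unaryAt τ e′ ∷ θ)   e = if does (e′ ≟ e) then just τ else typeIn θ e
    typeIn (binaryAt _ _ _ ∷ θ) e = typeIn θ e

    Extendable : Context → Set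
    Extendable θ = ∃ λ (𝒜 : Structure 𝒱 n) → 𝒜 ⊨ₛ Γ × 𝒜 ⊨ contextᶠ θ

    extendable? : (θ : Context) → Dec (Extendable θ)
    extendable? θ = anyStructure?
      (λ v≗w (p , q) → ⊨ₛ-resp Γ v≗w p , ⊨-resp (contextᶠ θ) v≗w q)
      (λ 𝒜 → (𝒜 ⊨ₛ? Γ) ×-dec T? (eval 𝒜 (contextᶠ θ)))

    branches : List GroundType → Context → (Context → NNF (GroundAtom 𝒱 n)) →
               List (NNF (GroundAtom 𝒱 n))
    branches gs θ rec =
      map (λ g → And (And (map lit (groundLiterals g)) ∷ rec (g ∷ θ) ∷ []))
          (filter (λ g → extendable? (g ∷ θ)) gs)

    -- The list holds the pairs from (i , j) on, in lexicographic order, so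
    -- that its tail starts at next (i , j); the terminal call has no pair left.
    -- Both lookups succeed, since Stage I has assigned a type to every element.
    stageII : List (Δ × Δ) → Context → NNF (GroundAtom 𝒱 n)
    stageII []             θ = ⊤ᶜ
    stageII ((i , j) ∷ ps) θ = Or (branches (map (λ π → binaryAt π i j) πs) θ (stageII ps))
      where
      πs : List (BinaryType 𝒱)
      πs = fromMaybe [] (zipWith ℬ (typeIn θ i) (typeIn θ j))

    pairs : List (Δ × Δ)
    pairs = filter (uncurry _<?_) (cartesianProduct (allFin n) (allFin n))

    -- The list holds the elements from eᵢ on; it is empty for i = n + 1.
    stageI : List Δ → Context → NNF (GroundAtom 𝒱 n)
    stageI []       θ = stageII pairs θ
    stageI (e ∷ es) θ = Or (branches (map (λ τ → unaryAt τ e) 𝒰) θ (stageI es))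

    twoStageCompilation : NNF (GroundAtom 𝒱 n)
    twoStageCompilation = stageI (allFin n) []

{-# OPTIONS --safe #-}

-- Each recursive call decides exactly the atoms of one block: the P(e) and
-- R(e,e) for an element e, or the R(eᵢ,eⱼ) and R(eⱼ,eᵢ) for a pair i < j.  The
-- blocks are disjoint, which gives decomposability, and distinct types of the
-- same block contradict each other, which gives determinism.  The blocks
-- exhaust all atoms, so a model v of the circuit coincides with the structure
-- witnessing the last extendability test of its branch, and this is a model of
-- Γ.  Conversely a model v of Γ follows the branch of its own types, all of
-- whose extendability tests it witnesses itself.
module Submission where

open import Defs
open import Data.Bool.Base using (Bool; true; false; T)
open import Data.Bool.Properties using (T-≡; T-not-≡; T-∧; T-∨)
open import Data.Fin.Base using (Fin; zero; suc; _<_)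
open import Data.Fin.Properties using (_≟_; _<?_; <-cmp; <-asym; <-irrefl)
open import Data.List.Base using (List; []; _∷_; _++_; map; concatMap; allFin; cartesianProduct)
import Data.List.Base as List
open import Data.List.Membership.Propositional using (_∈_; lose; find)
open import Data.List.Membership.Propositional.Properties
  using (∈-map⁺; ∈-map⁻; ∈-++⁺ˡ; ∈-++⁺ʳ; ∈-++⁻; ∈-concatMap⁺; ∈-filter⁺; ∈-filter⁻;
         ∈-cartesianProductWith⁺; ∈-cartesianProduct⁺; ∈-allFin)
open import Data.List.Properties using (map-++; map-∘; map-cong)
open import Data.List.Relation.Binary.Disjoint.Propositional using (Disjoint)
open import Data.List.Relation.Unary.All as All using (All; []; _∷_)
import Data.List.Relation.Unary.All.Properties as All
open import Data.List.Relation.Unary.AllPairs as AllPairs using (AllPairs; []; _∷_)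
import Data.List.Relation.Unary.AllPairs.Properties as AllPairs
open import Data.List.Relation.Unary.Any as Any using (Any; here; there)
import Data.List.Relation.Unary.Any.Properties as Any
open import Data.List.Relation.Unary.Unique.Propositional using (Unique)
import Data.List.Relation.Unary.Unique.Propositional.Properties as Unique
open import Data.Maybe.Base using (just; zipWith; fromMaybe)
open import Data.Nat.Base using (ℕ; zero; suc; _≥_)
open import Data.Product.Base using (∃; _×_; _,_; proj₁; proj₂; uncurry; map₂)
open import Data.Sum.Base using (_⊎_; inj₁; inj₂; [_,_]′)
open import Data.Unit.Base using (⊤)
open import Data.Vec.Base using (Vec; []; _∷_; lookup; tabulate)
open import Data.Vec.Properties using (∷-injective; lookup∘tabulate; tabulate∘lookup; tabulate-cong)
open import Function.Base using (_∘_; id)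
open import Function.Bundles using (_⇔_; mk⇔; Equivalence)
open import Relation.Binary.Construct.Closure.ReflexiveTransitive using (ε; _◅_)
open import Relation.Binary.Definitions using (tri<; tri≈; tri>)
open import Relation.Binary.PropositionalEquality
  using (_≡_; _≢_; _≗_; refl; sym; trans; cong; cong₂; subst)
open import Relation.Nullary.Decidable using (Dec; yes; no)
open import Relation.Nullary.Negation using (¬_; contradiction)

open Equivalence using (to; from)

-- Propositional formulas and NNF circuits.

module _ {A : Set} where

  ⋀ᶠ-⇔ : {B : Set} {v : Assignment A} (f : B → Formula A) (bs : List B) →
         v ⊨ ⋀ᶠ (map f bs) ⇔ All (λ b → v ⊨ f b) bs
  ⋀ᶠ-⇔ f []       = mk⇔ (λ _ → []) _
  ⋀ᶠ-⇔ f (b ∷ bs) = mk⇔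
    (λ p → let q , r = to T-∧ p in q ∷ to (⋀ᶠ-⇔ f bs) r)
    (λ { (q ∷ r) → from T-∧ (q , from (⋀ᶠ-⇔ f bs) r) })

  ⋁ᶠ-⇔ : {B : Set} {v : Assignment A} (f : B → Formula A) (bs : List B) →
         v ⊨ ⋁ᶠ (map f bs) ⇔ Any (λ b → v ⊨ f b) bs
  ⋁ᶠ-⇔ f []       = mk⇔ (λ ()) (λ ())
  ⋁ᶠ-⇔ f (b ∷ bs) = mk⇔
    (λ p → [ here , (λ q → there (to (⋁ᶠ-⇔ f bs) q)) ]′ (to T-∨ p))
    (λ { (here q) → from T-∨ (inj₁ q) ; (there q) → from T-∨ (inj₂ (from (⋁ᶠ-⇔ f bs) q)) })

  literalᶠ-signed : {v : Assignment A} (b : Bool) (a : A) → v ⊨ literalᶠ (signed b a) ⇔ v a ≡ b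
  literalᶠ-signed true  a = T-≡
  literalᶠ-signed false a = T-not-≡

  variableOf-signed : (b : Bool) (a : A) → variableOf (signed b a) ≡ a
  variableOf-signed true  a = refl
  variableOf-signed false a = refl

  literal-agree : {v w : Assignment A} (l : Literal A) →
                  v ⊨ literalᶠ l → w ⊨ literalᶠ l → v (variableOf l) ≡ w (variableOf l)
  literal-agree (pos a) p q = trans (to T-≡ p) (sym (to T-≡ q))
  literal-agree (neg a) p q = trans (to T-not-≡ p) (sym (to T-not-≡ q))

  -- Sign vectors turn pointwise agreement into an equation between vectors, so that realising a
  -- type becomes an equality of types.
  signs-⇔ : {v : Assignment A} {k : ℕ} (s : Vec Bool k) (f : Fin k → A) →
            All (λ l → v ⊨ literalᶠ l) (map (λ i → signed (lookup s i) (f i)) (allFin k)) ⇔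
            tabulate (v ∘ f) ≡ s
  signs-⇔ {v} s f = mk⇔
    (λ ps → trans (tabulate-cong λ i →
                     to (literalᶠ-signed (lookup s i) (f i)) (All.lookup (All.map⁻ ps) (∈-allFin i)))
                  (tabulate∘lookup s))
    (λ eq → All.map⁺ (All.tabulate λ {i} _ → from (literalᶠ-signed (lookup s i) (f i))
              (trans (sym (lookup∘tabulate (v ∘ f) i)) (cong (λ s → lookup s i) eq))))

  variables-signs : {k : ℕ} (s : Vec Bool k) (f : Fin k → A) →
                    map variableOf (map (λ i → signed (lookup s i) (f i)) (allFin k)) ≡ map f (allFin k)
  variables-signs s f = trans (sym (map-∘ (allFin _)))
                              (map-cong (λ i → variableOf-signed (lookup s i) (f i)) (allFin _))

  -- A path in `Star` is built from its lower end, whereas arguments about `C` need its last edge,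
  -- the one into `C`.
  ≼-inv : {C D : NNF A} → D ≼ C → D ≡ C ⊎ (∃ λ E → E ∈ children C × D ≼ E)
  ≼-inv ε = inj₁ refl
  ≼-inv (d ◅ p) with ≼-inv p
  ... | inj₁ refl        = inj₂ (_ , d , ε)
  ... | inj₂ (E , e , q) = inj₂ (E , e , d ◅ q)

  -- Every node other than the root lies below a child and is covered by it; the root adds a
  -- condition for decomposability only.
  ddnnf-⋀ : ∀ {S} → AllPairs DisjointVars S → All IsDDNNF S → IsDDNNF {A} (⋀ S)
  ddnnf-⋀ {S} disjoint ds = dec , det
    where
    dec : Decomposable (⋀ S)
    dec S′ p with ≼-inv p
    ... | inj₁ refl        = disjoint
    ... | inj₂ (E , e , q) = proj₁ (All.lookup ds e) S′ q

    det : Deterministic (⋀ S)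
    det S′ p with ≼-inv p
    ... | inj₂ (E , e , q) = proj₂ (All.lookup ds e) S′ q

  ddnnf-⋁ : ∀ {S} → AllPairs Inconsistent S → All IsDDNNF S → IsDDNNF {A} (⋁ S)
  ddnnf-⋁ {S} inconsistent ds = dec , det
    where
    dec : Decomposable (⋁ S)
    dec S′ p with ≼-inv p
    ... | inj₂ (E , e , q) = proj₁ (All.lookup ds e) S′ q

    det : Deterministic (⋁ S)
    det S′ p with ≼-inv p
    ... | inj₁ refl        = inconsistent
    ... | inj₂ (E , e , q) = proj₂ (All.lookup ds e) S′ q

  ddnnf-leaf : {C : NNF A} → (∀ S → ⋀ S ≢ C) → (∀ S → ⋁ S ≢ C) → children C ≡ [] → IsDDNNF C
  ddnnf-leaf {C} ≢⋀ ≢⋁ leaf = (λ S p → contradiction p (unreachable (≢⋀ S)))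
                            , (λ S p → contradiction p (unreachable (≢⋁ S)))
    where
    unreachable : ∀ {D} → D ≢ C → ¬ D ≼ C
    unreachable D≢C p with ≼-inv p
    ... | inj₁ D≡C = D≢C D≡C
    ... | inj₂ (E , e , q) with subst (E ∈_) leaf e
    ...   | ()

  ddnnf-lit : (l : Literal A) → IsDDNNF (lit l)
  ddnnf-lit l = ddnnf-leaf (λ _ ()) (λ _ ()) refl

  ddnnf-⊤ : IsDDNNF {A} ⊤ᶜ
  ddnnf-⊤ = ddnnf-leaf (λ _ ()) (λ _ ()) refl

  ddnnf-And : ∀ S → AllPairs DisjointVars S → All IsDDNNF S → IsDDNNF {A} (And S)
  ddnnf-And []      _ _ = ddnnf-⊤
  ddnnf-And (_ ∷ _)     = ddnnf-⋀

  ddnnf-Or : ∀ S → AllPairs Inconsistent S → All IsDDNNF S → IsDDNNF {A} (Or S)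
  ddnnf-Or []      _ _ = ddnnf-leaf (λ _ ()) (λ _ ()) refl
  ddnnf-Or (_ ∷ _)     = ddnnf-⋁

  And-⇔ : ∀ S {v : Assignment A} → v ⊨ᶜ And S ⇔ All (v ⊨ᶜ_) S
  And-⇔ []      = mk⇔ (λ _ → []) (λ _ → ⊤ᶜ)
  And-⇔ (_ ∷ _) = mk⇔ (λ { (⋀ p) → p }) ⋀

  Or-⇔ : ∀ S {v : Assignment A} → v ⊨ᶜ Or S ⇔ Any (v ⊨ᶜ_) S
  Or-⇔ []      = mk⇔ (λ ()) (λ ())
  Or-⇔ (_ ∷ _) = mk⇔ (λ { (⋁ p) → p }) ⋁

  ∈var-And : ∀ S {a : A} → a ∈var And S → Any (a ∈var_) S
  ∈var-And (_ ∷ _) (⋀ p) = p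

  ∈var-Or : ∀ S {a : A} → a ∈var Or S → Any (a ∈var_) S
  ∈var-Or (_ ∷ _) (⋁ p) = p

  cube : List (Literal A) → NNF A
  cube ls = And (map lit ls)

  cube-⇔ : ∀ ls {v : Assignment A} → v ⊨ᶜ cube ls ⇔ All (λ l → v ⊨ literalᶠ l) ls
  cube-⇔ ls = mk⇔
    (λ p → All.map (λ { (lit q) → q }) (All.map⁻ (to (And-⇔ (map lit ls)) p)))
    (λ ps → from (And-⇔ (map lit ls)) (All.map⁺ (All.map lit ps)))

  cube-vars : ∀ ls {a : A} → a ∈var cube ls → a ∈ map variableOf ls
  cube-vars ls p = Any.map⁺ (Any.map (λ { (lit q) → sym q }) (Any.map⁻ (∈var-And (map lit ls) p)))

  ddnnf-cube : ∀ ls → Unique (map variableOf ls) → IsDDNNF (cube ls)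
  ddnnf-cube ls u = ddnnf-And (map lit ls)
    (AllPairs.map⁺ (AllPairs.map (λ { ≢ a (lit p , lit q) → ≢ (trans p (sym q)) }) (AllPairs.map⁻ u)))
    (All.map⁺ (All.universal ddnnf-lit ls))

-- Duplicate-free lists and the enumeration of sign vectors.

unique-++⁻ : {A : Set} (xs : List A) {ys : List A} →
             Unique (xs ++ ys) → Unique xs × Unique ys × Disjoint xs ys
unique-++⁻ []       u = [] , u , λ ()
unique-++⁻ (x ∷ xs) (x∉ ∷ u) = let ux , uy , disjoint = unique-++⁻ xs u in
    All.++⁻ˡ xs x∉ ∷ ux , uy ,
    λ { (here refl , q) → All.lookup (All.++⁻ʳ xs x∉) q refl
      ; (there p , q)   → disjoint (p , q) }

-- The restriction to `P` is there because blocks are disjoint only for suitable slots: those of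
-- `(i , j)` and `(j , i)` have the same members.
unique-concatMap : {A B : Set} {P : A → Set} (f : A → List B) → (∀ a → P a → Unique (f a)) →
                   (∀ {a a′ b} → P a → P a′ → b ∈ f a → b ∈ f a′ → a ≡ a′) →
                   ∀ {as} → All P as → Unique as → Unique (concatMap f as)
unique-concatMap {P = P} f u same ps us =
  Unique.concat⁺ (All.map⁺ (All.map (u _) ps)) (AllPairs.map⁺ (go ps us))
  where
  go : ∀ {as} → All P as → Unique as → AllPairs (λ a a′ → Disjoint (f a) (f a′)) as
  go []       []       = []
  go (p ∷ ps) (a∉ ∷ us) =
    All.zipWith (λ { (≢ , p′) (q , q′) → ≢ (same p p′ q q′) }) (a∉ , ps) ∷ go ps us

allSigns-complete : ∀ {k} (s : Vec Bool k) → s ∈ allSigns k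
allSigns-complete []          = here refl
allSigns-complete (true ∷ s)  = ∈-cartesianProductWith⁺ _∷_ {xs = true ∷ false ∷ []} (here refl) (allSigns-complete s)
allSigns-complete (false ∷ s) = ∈-cartesianProductWith⁺ _∷_ {xs = true ∷ false ∷ []} (there (here refl)) (allSigns-complete s)

-- Determinism speaks of any two positions in the list of children, so a type listed twice could
-- spoil it.
allSigns-unique : ∀ k → Unique (allSigns k)
allSigns-unique zero    = [] ∷ []
allSigns-unique (suc k) =
  Unique.cartesianProductWith⁺ _∷_ ∷-injective (((λ ()) ∷ []) ∷ [] ∷ []) (allSigns-unique k)

-- Unary and binary types realised in a structure.

module _ {𝒱 : Vocabulary} where

  open Vocabulary 𝒱

  allUnaryTypes-complete : (τ : UnaryType 𝒱) → τ ∈ allUnaryTypes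
  allUnaryTypes-complete (mkUnary p r) =
    ∈-cartesianProductWith⁺ mkUnary (allSigns-complete p) (allSigns-complete r)

  allBinaryTypes-complete : (π : BinaryType 𝒱) → π ∈ allBinaryTypes
  allBinaryTypes-complete (mkBinary f b) =
    ∈-cartesianProductWith⁺ mkBinary (allSigns-complete f) (allSigns-complete b)

  allUnaryTypes-unique : Unique (allUnaryTypes {𝒱})
  allUnaryTypes-unique =
    Unique.cartesianProductWith⁺ mkUnary (λ { refl → refl , refl }) (allSigns-unique _) (allSigns-unique _)

  allBinaryTypes-unique : Unique (allBinaryTypes {𝒱})
  allBinaryTypes-unique =
    Unique.cartesianProductWith⁺ mkBinary (λ { refl → refl , refl }) (allSigns-unique _) (allSigns-unique _)

  module _ {T : Set} where

    unaryTypeOf : Assignment (Atom 𝒱 T) → T → UnaryType 𝒱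
    unaryTypeOf v t = mkUnary (tabulate λ P → v (unary P t)) (tabulate λ R → v (binary R t t))

    binaryTypeOf : Assignment (Atom 𝒱 T) → T → T → BinaryType 𝒱
    binaryTypeOf v s t = mkBinary (tabulate λ R → v (binary R s t)) (tabulate λ R → v (binary R t s))

    unaryAtoms : T → List (Atom 𝒱 T)
    unaryAtoms t = map (λ P → unary P t) (allFin #unary) ++ map (λ R → binary R t t) (allFin #binary)

    binaryAtoms : T → T → List (Atom 𝒱 T)
    binaryAtoms s t = map (λ R → binary R s t) (allFin #binary) ++ map (λ R → binary R t s) (allFin #binary)

    unaryLiterals-vars : ∀ τ t → map variableOf (unaryLiterals τ t) ≡ unaryAtoms t
    unaryLiterals-vars (mkUnary p r) t =
      trans (map-++ variableOf (map (λ P → signed (lookup p P) (unary P t)) (allFin #unary)) _)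
            (cong₂ _++_ (variables-signs p _) (variables-signs r _))

    binaryLiterals-vars : ∀ π s t → map variableOf (binaryLiterals π s t) ≡ binaryAtoms s t
    binaryLiterals-vars (mkBinary f b) s t =
      trans (map-++ variableOf (map (λ R → signed (lookup f R) (binary R s t)) (allFin #binary)) _)
            (cong₂ _++_ (variables-signs f _) (variables-signs b _))

    -- A type gives a sign to every atom over its term, so its formula leaves no freedom: the type
    -- is the one realised.
    unaryᶠ-⇔ : {v : Assignment (Atom 𝒱 T)} (τ : UnaryType 𝒱) (t : T) →
               v ⊨ unaryᶠ τ t ⇔ unaryTypeOf v t ≡ τ
    unaryᶠ-⇔ τ@(mkUnary p r) t = mk⇔
      (λ h → let hp , hr = All.++⁻ _ (to (⋀ᶠ-⇔ literalᶠ (unaryLiterals τ t)) h)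
             in cong₂ mkUnary (to (signs-⇔ p _) hp) (to (signs-⇔ r _) hr))
      (λ eq → from (⋀ᶠ-⇔ literalᶠ (unaryLiterals τ t))
                (All.++⁺ (from (signs-⇔ p _) (cong UnaryType.signP eq))
                         (from (signs-⇔ r _) (cong UnaryType.signR eq))))

    binaryᶠ-⇔ : {v : Assignment (Atom 𝒱 T)} (π : BinaryType 𝒱) (s t : T) →
                v ⊨ binaryᶠ π s t ⇔ binaryTypeOf v s t ≡ π
    binaryᶠ-⇔ π@(mkBinary f b) s t = mk⇔
      (λ h → let hf , hb = All.++⁻ _ (to (⋀ᶠ-⇔ literalᶠ (binaryLiterals π s t)) h)
             in cong₂ mkBinary (to (signs-⇔ f _) hf) (to (signs-⇔ b _) hb))
      (λ eq → from (⋀ᶠ-⇔ literalᶠ (binaryLiterals π s t))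
                (All.++⁺ (from (signs-⇔ f _) (cong BinaryType.forward eq))
                         (from (signs-⇔ b _) (cong BinaryType.backward eq))))

  tabulate-injective : {k : ℕ} {f g : Fin k → Bool} → tabulate f ≡ tabulate g → f ≗ g
  tabulate-injective {f = f} {g} eq i =
    trans (sym (lookup∘tabulate f i)) (trans (cong (λ s → lookup s i) eq) (lookup∘tabulate g i))

  reverse : BinaryType 𝒱 → BinaryType 𝒱
  reverse (mkBinary f b) = mkBinary b f

  -- The type of a pair (t,t), both of whose directions are the diagonal atoms R(t,t) already fixed
  -- by the unary type.
  loop : UnaryType 𝒱 → BinaryType 𝒱
  loop (mkUnary p r) = mkBinary r r

  -- The truth of φ(s,t) only depends on the types of s, of t and of (s,t).
  QF-resp : {T U : Set} {v : Assignment (Atom 𝒱 T)} {w : Assignment (Atom 𝒱 U)} {s t : T} {s′ t′ : U}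
            (F : QF 𝒱) →
            unaryTypeOf v s ≡ unaryTypeOf w s′ → unaryTypeOf v t ≡ unaryTypeOf w t′ →
            binaryTypeOf v s t ≡ binaryTypeOf w s′ t′ →
            v ⊨ F ⟨ s , t ⟩ → w ⊨ F ⟨ s′ , t′ ⟩
  QF-resp {v = v} {w} {s} {t} {s′} {t′} F eq₁ eq₂ eq =
    subst T (trans (eval-map agree F) (sym (eval-map (λ _ → refl) F)))
    where
    agree : v ∘ mapᵃ (assign s t) ≗ w ∘ mapᵃ (assign s′ t′)
    agree (unary P 𝐱)    = tabulate-injective (cong UnaryType.signP eq₁) P
    agree (unary P 𝐲)    = tabulate-injective (cong UnaryType.signP eq₂) P
    agree (binary R 𝐱 𝐱) = tabulate-injective (cong UnaryType.signR eq₁) R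
    agree (binary R 𝐱 𝐲) = tabulate-injective (cong BinaryType.forward eq) R
    agree (binary R 𝐲 𝐱) = tabulate-injective (cong BinaryType.backward eq) R
    agree (binary R 𝐲 𝐲) = tabulate-injective (cong UnaryType.signR eq₂) R

  ⟨⟩-eval : {T : Set} {v : Assignment (Atom 𝒱 T)} {s t : T} (F : Formula (Atom 𝒱 Var)) →
            eval v (F ⟨ s , t ⟩) ≡ eval (v ∘ mapᵃ (assign s t)) F
  ⟨⟩-eval F = eval-map (λ _ → refl) F

  -- The sentence in Scott normal form and the types occurring in its models.

  module _ (Γ : ScottNormalForm 𝒱) where

    open ScottNormalForm Γ

    grounding-⇔ : ∀ {n} {v : Structure 𝒱 n} → v ⊨ grounding Γ n ⇔ v ⊨ₛ Γ
    grounding-⇔ {n} {v} = mk⇔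
      (λ h → let p , q = to T-∧ h in
         (λ a b → ⋀-elim (λ b → φ ⟨ a , b ⟩) (⋀-elim (λ a → ⋀ᶠ (map (λ b → φ ⟨ a , b ⟩) (allFin n))) p a) b) ,
         (λ k a → Any.satisfied (to (⋁ᶠ-⇔ (λ b → β k ⟨ a , b ⟩) (allFin n))
                    (⋀-elim (λ a → ⋁ᶠ (map (λ b → β k ⟨ a , b ⟩) (allFin n)))
                      (⋀-elim (λ k → ⋀ᶠ (map (λ a → ⋁ᶠ (map (λ b → β k ⟨ a , b ⟩) (allFin n))) (allFin n)))
                              q k) a))))
      (λ { (p , q) → from T-∧
         ( ⋀-intro (λ a → ⋀ᶠ (map (λ b → φ ⟨ a , b ⟩) (allFin n))) (λ a →
             ⋀-intro (λ b → φ ⟨ a , b ⟩) (p a))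
         , ⋀-intro (λ k → ⋀ᶠ (map (λ a → ⋁ᶠ (map (λ b → β k ⟨ a , b ⟩) (allFin n))) (allFin n))) (λ k →
             ⋀-intro (λ a → ⋁ᶠ (map (λ b → β k ⟨ a , b ⟩) (allFin n))) (λ a →
               from (⋁ᶠ-⇔ (λ b → β k ⟨ a , b ⟩) (allFin n))
                    (lose (∈-allFin (proj₁ (q k a))) (proj₂ (q k a)))))) })
      where
      ⋀-elim : ∀ {k} (f : Fin k → Formula (GroundAtom 𝒱 n)) →
               v ⊨ ⋀ᶠ (map f (allFin k)) → ∀ i → v ⊨ f i
      ⋀-elim f p i = All.lookup (to (⋀ᶠ-⇔ f (allFin _)) p) (∈-allFin i)

      ⋀-intro : ∀ {k} (f : Fin k → Formula (GroundAtom 𝒱 n)) →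
                (∀ i → v ⊨ f i) → v ⊨ ⋀ᶠ (map f (allFin k))
      ⋀-intro f p = from (⋀ᶠ-⇔ f (allFin _)) (All.tabulate λ {i} _ → p i)

    module _ {n : ℕ} {v : Structure 𝒱 n} (v⊨Γ : v ⊨ₛ Γ) where

      -- Since `v` satisfies φ(e,e) and the type of x fixes the truth of φ(x,x), every structure
      -- realising this type satisfies φ(x,x) too.
      unaryTypeOf-valid : ∀ e → unaryTypeOf v e ∈ 𝒰 Γ
      unaryTypeOf-valid e = ∈-filter⁺ (valid? Γ) (allUnaryTypes-complete _) valid
        where
        valid : Valid Γ (unaryTypeOf v e)
        valid k 𝒜 a b h = subst T (sym (⟨⟩-eval (φ ⟨ 𝐱 , 𝐱 ⟩)))
          (QF-resp φ (sym same) (sym same) (cong loop (sym same)) (proj₁ v⊨Γ e e))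
          where
          same : unaryTypeOf (𝒜 ∘ mapᵃ (assign a b)) 𝐱 ≡ unaryTypeOf v e
          same = to (unaryᶠ-⇔ _ 𝐱) (subst T (⟨⟩-eval (unaryᶠ (unaryTypeOf v e) 𝐱)) h)

      -- The instances φ(i,j) and φ(j,i) that hold in `v` are transferred by their types, the second
      -- one through `reverse`.
      binaryTypeOf-compatible : ∀ i j →
        binaryTypeOf v i j ∈ ℬ Γ (unaryTypeOf v i) (unaryTypeOf v j)
      binaryTypeOf-compatible i j = ∈-filter⁺ (compatible? Γ (unaryTypeOf v i) (unaryTypeOf v j)) (allBinaryTypes-complete _) compatible
        where
        compatible : Compatible Γ (unaryTypeOf v i) (unaryTypeOf v j) (binaryTypeOf v i j)
        compatible k 𝒜 a b h = subst T (sym (⟨⟩-eval (φ ⟨ 𝐱 , 𝐲 ⟩ ∧ᶠ φ ⟨ 𝐲 , 𝐱 ⟩)))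
          (from T-∧ ( QF-resp φ (sym eqx) (sym eqy) (sym eq) (proj₁ v⊨Γ i j)
                    , QF-resp φ (sym eqy) (sym eqx) (cong reverse (sym eq)) (proj₁ v⊨Γ j i)))
          where
          -- Pulling back to the domain `Var` keeps 𝐱 and 𝐲 distinct even if `a` and `b` coincide.
          B : Structure 𝒱 2
          B = 𝒜 ∘ mapᵃ (assign a b)

          types : B ⊨ unaryᶠ (unaryTypeOf v i) 𝐱 × B ⊨ unaryᶠ (unaryTypeOf v j) 𝐲
                × B ⊨ binaryᶠ (binaryTypeOf v i j) 𝐱 𝐲
          types = map₂ (to T-∧) (to T-∧ (subst T (⟨⟩-eval (unaryᶠ (unaryTypeOf v i) 𝐱
                    ∧ᶠ unaryᶠ (unaryTypeOf v j) 𝐲 ∧ᶠ binaryᶠ (binaryTypeOf v i j) 𝐱 𝐲)) h))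

          eqx : unaryTypeOf B 𝐱 ≡ unaryTypeOf v i
          eqx = to (unaryᶠ-⇔ _ 𝐱) (proj₁ types)

          eqy : unaryTypeOf B 𝐲 ≡ unaryTypeOf v j
          eqy = to (unaryᶠ-⇔ _ 𝐲) (proj₁ (proj₂ types))

          eq : binaryTypeOf B 𝐱 𝐲 ≡ binaryTypeOf v i j
          eq = to (binaryᶠ-⇔ _ 𝐱 𝐲) (proj₂ (proj₂ types))

-- Partition of the ground atoms into blocks.

module _ {n : ℕ} where

  -- inj₁ e stands for the atoms decided together with the unary type of e, and
  -- inj₂ (i , j) for those decided together with the binary type of (i , j).
  Slot : Set
  Slot = Fin n ⊎ (Fin n × Fin n)

  -- Keeps one of the pairs (i,j) and (j,i), whose blocks have the same members, and discards (i,i),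
  -- whose atoms belong to the block of i.
  Ordered : Slot → Set
  Ordered (inj₁ e)       = ⊤
  Ordered (inj₂ (i , j)) = i < j

module _ {𝒱 : Vocabulary} {n : ℕ} where

  open Vocabulary 𝒱

  block : Slot {n} → List (GroundAtom 𝒱 n)
  block (inj₁ e)       = unaryAtoms e
  block (inj₂ (i , j)) = binaryAtoms i j

  data _At_ : GroundAtom 𝒱 n → Slot → Set where
    unary    : ∀ {P e}   → unary P e At inj₁ e
    diagonal : ∀ {R e}   → binary R e e At inj₁ e
    forward  : ∀ {R i j} → binary R i j At inj₂ (i , j)
    backward : ∀ {R i j} → binary R j i At inj₂ (i , j)

  ∈block⇒At : ∀ s {a} → a ∈ block s → a At s
  ∈block⇒At (inj₁ e) p with ∈-++⁻ (map (λ P → unary P e) (allFin #unary)) p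
  ... | inj₁ q with _ , _ , refl ← ∈-map⁻ _ q = unary
  ... | inj₂ q with _ , _ , refl ← ∈-map⁻ _ q = diagonal
  ∈block⇒At (inj₂ (i , j)) p with ∈-++⁻ (map (λ R → binary R i j) (allFin #binary)) p
  ... | inj₁ q with _ , _ , refl ← ∈-map⁻ _ q = forward
  ... | inj₂ q with _ , _ , refl ← ∈-map⁻ _ q = backward

  At⇒∈block : ∀ {s a} → a At s → a ∈ block s
  At⇒∈block unary    = ∈-++⁺ˡ (∈-map⁺ (λ P → unary P _) (∈-allFin _))
  At⇒∈block diagonal = ∈-++⁺ʳ (map _ (allFin #unary)) (∈-map⁺ _ (∈-allFin _))
  At⇒∈block forward  = ∈-++⁺ˡ (∈-map⁺ (λ R → binary R _ _) (∈-allFin _))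
  At⇒∈block backward = ∈-++⁺ʳ (map _ (allFin #binary)) (∈-map⁺ _ (∈-allFin _))

  At-unique : ∀ {s s′ a} → Ordered s → Ordered s′ → a At s → a At s′ → s ≡ s′
  At-unique o o′ unary    unary    = refl
  At-unique o o′ diagonal diagonal = refl
  At-unique o o′ diagonal forward  = contradiction o′ (<-irrefl refl)
  At-unique o o′ diagonal backward = contradiction o′ (<-irrefl refl)
  At-unique o o′ forward  diagonal = contradiction o (<-irrefl refl)
  At-unique o o′ forward  forward  = refl
  At-unique o o′ forward  backward = contradiction o′ (<-asym o)
  At-unique o o′ backward diagonal = contradiction o (<-irrefl refl)
  At-unique o o′ backward forward  = contradiction o′ (<-asym o)
  At-unique o o′ backward backward = refl

  block-unique : ∀ s → Ordered s → Unique (block s)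
  block-unique (inj₁ e) _ = Unique.++⁺
    (Unique.map⁺ (λ { refl → refl }) (Unique.allFin⁺ _))
    (Unique.map⁺ (λ { refl → refl }) (Unique.allFin⁺ _))
    λ (p , q) → case∈ (∈-map⁻ _ p) (∈-map⁻ _ q)
    where
    case∈ : ∀ {a} → (∃ λ P → P ∈ allFin #unary × a ≡ unary P e) →
            ¬ (∃ λ R → R ∈ allFin #binary × a ≡ binary R e e)
    case∈ (_ , _ , refl) (_ , _ , ())
  block-unique (inj₂ (i , j)) i<j = Unique.++⁺
    (Unique.map⁺ (λ { refl → refl }) (Unique.allFin⁺ _))
    (Unique.map⁺ (λ { refl → refl }) (Unique.allFin⁺ _))
    λ (p , q) → case∈ (∈-map⁻ _ p) (∈-map⁻ _ q)
    where
    case∈ : ∀ {a} → (∃ λ R → R ∈ allFin #binary × a ≡ binary R i j) →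
            ¬ (∃ λ R → R ∈ allFin #binary × a ≡ binary R j i)
    -- R(i,j) and R(j,i) are the same atom only if i = j.
    case∈ (_ , _ , refl) (_ , _ , refl) = <-irrefl refl i<j

  atoms : List Slot → List (GroundAtom 𝒱 n)
  atoms = concatMap block

  atoms-unique : ∀ {ss} → All Ordered ss → Unique ss → Unique (atoms ss)
  atoms-unique = unique-concatMap block block-unique
    (λ {s} {s′} o o′ p q → At-unique o o′ (∈block⇒At s p) (∈block⇒At s′ q))

-- Correctness of the recursion.

module _ {𝒱 : Vocabulary} (Γ : ScottNormalForm 𝒱) (n : ℕ) where

  groundTypeᶠ-⇔ : ∀ {v} g → v ⊨ groundTypeᶠ Γ n g ⇔ All (λ l → v ⊨ literalᶠ l) (groundLiterals Γ n g)
  groundTypeᶠ-⇔ (unaryAt τ e)    = ⋀ᶠ-⇔ literalᶠ (unaryLiterals τ e)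
  groundTypeᶠ-⇔ (binaryAt π i j) = ⋀ᶠ-⇔ literalᶠ (binaryLiterals π i j)

  -- The invariant of the recursion: C is what the algorithm returns on θ when
  -- the atoms xs are still undecided.
  record Decides (xs : List (GroundAtom 𝒱 n)) (θ : Context Γ n) (C : NNF (GroundAtom 𝒱 n)) : Set where
    field
      ddnnf    : IsDDNNF C
      vars     : ∀ {a} → a ∈var C → a ∈ xs
      sound    : ∀ {v} → v ⊨ᶜ C →
                 ∃ λ 𝒜 → 𝒜 ⊨ₛ Γ × 𝒜 ⊨ contextᶠ Γ n θ × (∀ {a} → a ∈ xs → 𝒜 a ≡ v a)
      complete : ∀ {v} → v ⊨ₛ Γ → v ⊨ contextᶠ Γ n θ → v ⊨ᶜ C

  open Decides

  -- Common setting of both stages: `c` places a type at the current slot, `typeOf` reads off the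
  -- type realised there, and `ys` lists the atoms of the slot.
  module _ {X : Set} (c : X → GroundType Γ n) (typeOf : Structure 𝒱 n → X)
           (realises : ∀ {v} x → v ⊨ groundTypeᶠ Γ n (c x) ⇔ typeOf v ≡ x)
           {ys : List (GroundAtom 𝒱 n)}
           (c-vars : ∀ x → map variableOf (groundLiterals Γ n (c x)) ≡ ys) where

    -- Decomposability comes from `ys` and `zs` being disjoint, determinism from distinct types
    -- having no common model. The third hypothesis ensures that the type realised by a model of `Γ`
    -- and `θ` is among those tried.
    branches-decide : ∀ {xs zs θ} rec → Unique xs → Unique (ys ++ zs) →
      (∀ {v} → v ⊨ₛ Γ → v ⊨ contextᶠ Γ n θ → typeOf v ∈ xs) →
      (∀ x → Extendable Γ n (c x ∷ θ) → Decides zs (c x ∷ θ) (rec (c x ∷ θ))) →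
      Decides (ys ++ zs) θ (Or (branches Γ n (map c xs) θ rec))
    branches-decide {xs} {zs} {θ} rec xs! ys++zs! admissible rec-decides = record
      { ddnnf    = ddnnf-Or bs
                     (AllPairs.map⁺ (AllPairs.filter⁺ ext? (AllPairs.map⁺ (AllPairs.map inconsistent xs!))))
                     (All.tabulate bs-ddnnf)
      ; vars     = λ p → bs-vars (find (∈var-Or bs p))
      ; sound    = λ p → bs-sound (find (to (Or-⇔ bs) p))
      ; complete = λ {v} v⊨Γ v⊨θ →
          let v⊨c = from (realises (typeOf v)) refl
              v⊨cθ = from T-∧ (v⊨c , v⊨θ)
              -- The model to be accepted is itself the witness of the extendability test, so its
              -- branch survives the filter.
              ext = v , v⊨Γ , v⊨cθ
          in from (Or-⇔ bs) (lose
               (∈-map⁺ nodeOf (∈-filter⁺ ext? (∈-map⁺ c (admissible v⊨Γ v⊨θ)) ext))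
               (⋀ (from (cube-⇔ _) (to (groundTypeᶠ-⇔ (c (typeOf v))) v⊨c)
                   ∷ complete (rec-decides _ ext) v⊨Γ v⊨cθ ∷ [])))
      }
      where
      ext? : (g : GroundType Γ n) → Dec (Extendable Γ n (g ∷ θ))
      ext? g = extendable? Γ n (g ∷ θ)

      bs : List (NNF (GroundAtom 𝒱 n))
      bs = branches Γ n (map c xs) θ rec

      nodeOf : GroundType Γ n → NNF (GroundAtom 𝒱 n)
      nodeOf g = And (cube (groundLiterals Γ n g) ∷ rec (g ∷ θ) ∷ [])

      node : X → NNF (GroundAtom 𝒱 n)
      node x = nodeOf (c x)

      ys!,zs!,disjoint = unique-++⁻ ys ys++zs!

      branch : ∀ {C} → C ∈ bs → ∃ λ x → C ≡ node x × Extendable Γ n (c x ∷ θ)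
      branch C∈ with g , g∈ , refl ← ∈-map⁻ nodeOf C∈
                with g∈′ , ext ← ∈-filter⁻ ext? {xs = map c xs} g∈
                with x , _ , refl ← ∈-map⁻ c g∈′ = x , refl , ext

      cube-vars′ : ∀ {x a} → a ∈var cube (groundLiterals Γ n (c x)) → a ∈ ys
      cube-vars′ {x} p = subst (_ ∈_) (c-vars x) (cube-vars _ p)

      -- The first conjunct contains the whole ground type, so a model of the node reveals its
      -- label.
      node-type : ∀ {v x} → v ⊨ᶜ node x → typeOf v ≡ x
      node-type {x = x} (⋀ (p ∷ _)) = to (realises x) (from (groundTypeᶠ-⇔ (c x)) (to (cube-⇔ _) p))

      inconsistent : ∀ {x y} → x ≢ y → Inconsistent (node x) (node y)
      inconsistent x≢y v (p , q) = x≢y (trans (sym (node-type p)) (node-type q))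

      bs-ddnnf : ∀ {C} → C ∈ bs → IsDDNNF C
      bs-ddnnf C∈ with x , refl , ext ← branch C∈ = ddnnf-⋀
        (((λ a (p , q) → proj₂ (proj₂ ys!,zs!,disjoint)
                           (cube-vars′ {x} p , vars (rec-decides x ext) q)) ∷ []) ∷ [] ∷ [])
        ( ddnnf-cube _ (subst Unique (sym (c-vars x)) (proj₁ ys!,zs!,disjoint))
        ∷ ddnnf (rec-decides x ext) ∷ [])

      bs-vars : ∀ {a} → (∃ λ C → C ∈ bs × a ∈var C) → a ∈ ys ++ zs
      bs-vars (C , C∈ , p) with branch C∈
      bs-vars (C , C∈ , ⋀ (here p))         | x , refl , ext = ∈-++⁺ˡ (cube-vars′ {x} p)
      bs-vars (C , C∈ , ⋀ (there (here p))) | x , refl , ext = ∈-++⁺ʳ ys (vars (rec-decides x ext) p)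

      -- The structure found by the recursive call also satisfies `c x`, the newest conjunct of its
      -- context. Hence it agrees with `v` on `ys`, where both satisfy the same literals, and on
      -- `zs` by recursion.
      bs-sound : ∀ {v} → (∃ λ C → C ∈ bs × v ⊨ᶜ C) →
        ∃ λ 𝒜 → 𝒜 ⊨ₛ Γ × 𝒜 ⊨ contextᶠ Γ n θ × (∀ {a} → a ∈ ys ++ zs → 𝒜 a ≡ v a)
      bs-sound {v} (C , C∈ , p) with branch C∈
      bs-sound {v} (C , C∈ , ⋀ (p ∷ q ∷ [])) | x , refl , ext
        with 𝒜 , 𝒜⊨Γ , 𝒜⊨cθ , agree ← sound (rec-decides x ext) q
        with 𝒜⊨c , 𝒜⊨θ ← to (T-∧ {eval 𝒜 (groundTypeᶠ Γ n (c x))}) 𝒜⊨cθ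
        = 𝒜 , 𝒜⊨Γ , 𝒜⊨θ , λ a∈ → agree′ (∈-++⁻ ys a∈)
        where
        agree-ys : ∀ {a} → (∃ λ l → l ∈ groundLiterals Γ n (c x) × a ≡ variableOf l) → 𝒜 a ≡ v a
        agree-ys (l , l∈ , refl) = literal-agree l
          (All.lookup (to (groundTypeᶠ-⇔ (c x)) 𝒜⊨c) l∈) (All.lookup (to (cube-⇔ _) p) l∈)

        agree′ : ∀ {a} → a ∈ ys ⊎ a ∈ zs → 𝒜 a ≡ v a
        agree′ (inj₁ a∈ys) = agree-ys (∈-map⁻ variableOf (subst (_ ∈_) (sym (c-vars x)) a∈ys))
        agree′ (inj₂ a∈zs) = agree a∈zs

  -- The type found is a conjunct of the context, and satisfying that conjunct means realising the
  -- type at `e`.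
  typeIn-sound : ∀ {v e τ} (θ : Context Γ n) → typeIn Γ n θ e ≡ just τ → v ⊨ contextᶠ Γ n θ → unaryTypeOf v e ≡ τ
  typeIn-sound {v} {e} (g@(unaryAt τ e′) ∷ θ) eq v⊨gθ
    with v⊨g , v⊨θ ← to (T-∧ {eval v (groundTypeᶠ Γ n g)}) v⊨gθ
    with e′ ≟ e
  typeIn-sound (unaryAt τ e′ ∷ θ) refl v⊨gθ | yes refl = to (unaryᶠ-⇔ τ e′) v⊨g
  typeIn-sound (unaryAt τ e′ ∷ θ) eq v⊨gθ | no _ = typeIn-sound θ eq v⊨θ
  typeIn-sound {v} (g@(binaryAt π i j) ∷ θ) eq v⊨gθ =
    typeIn-sound θ eq (proj₂ (to (T-∧ {eval v (groundTypeᶠ Γ n g)}) v⊨gθ))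

  Typed : Context Γ n → Fin n → Set
  Typed θ e = ∃ λ τ → typeIn Γ n θ e ≡ just τ

  -- Extendability serves the terminal call, where its witness becomes the structure demanded by
  -- `sound`; no atom is left on which it would have to agree with `v`.
  stageII-decides : ∀ ps {θ} → Unique (atoms {𝒱} (map inj₂ ps)) → (∀ e → Typed θ e) →
                    Extendable Γ n θ → Decides (atoms (map inj₂ ps)) θ (stageII Γ n ps θ)
  stageII-decides [] _ _ (𝒜 , 𝒜⊨Γ , 𝒜⊨θ) = record
    { ddnnf    = ddnnf-⊤
    ; vars     = λ ()
    ; sound    = λ _ → 𝒜 , 𝒜⊨Γ , 𝒜⊨θ , λ ()
    ; complete = λ _ _ → ⊤ᶜ
    }
  stageII-decides ((i , j) ∷ ps) {θ} u typed _ with τ , eq ← typed i with τ′ , eq′ ← typed j =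
    -- Both lookups succeed, so the default `[]` is not taken and the candidates are `ℬ Γ τ τ′`.
    subst (λ πs → Decides (atoms (map inj₂ ((i , j) ∷ ps))) θ
                    (Or (branches Γ n (map (λ π → binaryAt π i j) πs) θ (stageII Γ n ps))))
          (sym (cong₂ (λ t t′ → fromMaybe [] (zipWith (ℬ Γ) t t′)) eq eq′))
          (branches-decide (λ π → binaryAt π i j) (λ v → binaryTypeOf v i j)
            (λ π → binaryᶠ-⇔ π i j) (λ π → binaryLiterals-vars π i j)
            (stageII Γ n ps) (Unique.filter⁺ (compatible? Γ τ τ′) allBinaryTypes-unique) u
            -- The types recorded in `θ` are those realised by `v`, so the list of candidates is the
            -- one for the types of `v`.
            (λ {v} v⊨Γ v⊨θ → subst (binaryTypeOf v i j ∈_)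
              (cong₂ (ℬ Γ) (typeIn-sound θ eq v⊨θ) (typeIn-sound θ eq′ v⊨θ))
              (binaryTypeOf-compatible Γ v⊨Γ i j))
            (λ π ext → stageII-decides ps (proj₁ (proj₂ (unique-++⁻ (binaryAtoms i j) u))) typed ext))

  pending : List (Fin n) → List (GroundAtom 𝒱 n)
  pending es = atoms (map inj₁ es ++ map inj₂ (pairs Γ n))

  -- Extendability is asked only of the contexts passed on, which the algorithm has just tested; so
  -- the step also serves the initial call, whose empty context is untested.
  stageI-step : ∀ e es {θ} → Unique (pending (e ∷ es)) →
    (∀ τ → Extendable Γ n (unaryAt τ e ∷ θ) →
      Decides (pending es) (unaryAt τ e ∷ θ) (stageI Γ n es (unaryAt τ e ∷ θ))) →
    Decides (pending (e ∷ es)) θ (stageI Γ n (e ∷ es) θ)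
  stageI-step e es u = branches-decide (λ τ → unaryAt τ e) (λ v → unaryTypeOf v e)
    (λ τ → unaryᶠ-⇔ τ e) (λ τ → unaryLiterals-vars τ e)
    (stageI Γ n es) (Unique.filter⁺ (valid? Γ) allUnaryTypes-unique) u
    (λ v⊨Γ _ → unaryTypeOf-valid Γ v⊨Γ e)

  -- Invariant of Stage I: an element is either still waiting or already typed. Once none is
  -- waiting, every lookup of Stage II succeeds.
  typed-extend : ∀ {e es τ} θ → (∀ e′ → e′ ∈ e ∷ es ⊎ Typed θ e′) →
                 ∀ e′ → e′ ∈ es ⊎ Typed (unaryAt τ e ∷ θ) e′
  typed-extend {e} {τ = τ} θ typed e′ with e ≟ e′ | typed e′
  ... | yes _   | _                = inj₂ (τ , refl)
  ... | no _    | inj₂ t           = inj₂ t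
  ... | no _    | inj₁ (there e′∈) = inj₁ e′∈
  ... | no e≢e′ | inj₁ (here refl) = contradiction refl e≢e′

  stageI-decides : ∀ es {θ} → Unique (pending es) → (∀ e → e ∈ es ⊎ Typed θ e) → Extendable Γ n θ →
                   Decides (pending es) θ (stageI Γ n es θ)
  stageI-decides []       u typed ext = stageII-decides (pairs Γ n) u (λ e → [ (λ ()) , id ]′ (typed e)) ext
  stageI-decides (e ∷ es) {θ} u typed _   = stageI-step e es u λ τ ext →
    stageI-decides es (proj₁ (proj₂ (unique-++⁻ (unaryAtoms e) u))) (typed-extend θ typed) ext

  -- The initial call: its blocks contain each atom exactly once.

  pending-unique : Unique (pending (allFin n))
  pending-unique = atoms-unique
    (All.++⁺ (All.map⁺ (All.universal _ (allFin n)))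
             (All.map⁺ (All.all-filter (uncurry _<?_) (cartesianProduct (allFin n) (allFin n)))))
    (Unique.++⁺ (Unique.map⁺ (λ { refl → refl }) (Unique.allFin⁺ n))
                (Unique.map⁺ (λ { refl → refl }) (Unique.filter⁺ (uncurry _<?_)
                  (Unique.cartesianProduct⁺ (Unique.allFin⁺ n) (Unique.allFin⁺ n))))
                λ (p , q) → apart (∈-map⁻ inj₁ p) (∈-map⁻ inj₂ q))
    where
    apart : ∀ {s : Slot {n}} → (∃ λ e → e ∈ allFin n × s ≡ inj₁ e) → ¬ (∃ λ p → p ∈ pairs Γ n × s ≡ inj₂ p)
    apart (_ , _ , refl) (_ , _ , ())

  -- Trichotomy on the two arguments selects the block of a binary atom. Agreement on the pending
  -- atoms thereby becomes agreement everywhere.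
  pending-exhaustive : ∀ a → a ∈ pending (allFin n)
  pending-exhaustive a = let _ , s∈ , at = slot a in ∈-concatMap⁺ block (lose s∈ (At⇒∈block at))
    where
    element : ∀ e → inj₁ e ∈ map inj₁ (allFin n) ++ map inj₂ (pairs Γ n)
    element e = ∈-++⁺ˡ (∈-map⁺ inj₁ (∈-allFin e))

    pair : ∀ {i j} → i < j → inj₂ (i , j) ∈ map inj₁ (allFin n) ++ map inj₂ (pairs Γ n)
    pair i<j = ∈-++⁺ʳ (map inj₁ (allFin n)) (∈-map⁺ inj₂
      (∈-filter⁺ (uncurry _<?_) (∈-cartesianProduct⁺ (∈-allFin _) (∈-allFin _)) i<j))

    slot : ∀ a → ∃ λ s → s ∈ map inj₁ (allFin n) ++ map inj₂ (pairs Γ n) × a At s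
    slot (unary P e) = inj₁ e , element e , unary
    slot (binary R i j) with <-cmp i j
    ... | tri< i<j _ _  = inj₂ (i , j) , pair i<j , forward
    ... | tri≈ _ refl _ = inj₁ i , element i , diagonal
    ... | tri> _ _ j<i  = inj₂ (j , i) , pair j<i , backward

-- For n ≥ 1 the first call already tests extendability, so the empty context
-- need not be extendable.
twoStage-decides : ∀ {𝒱} (Γ : ScottNormalForm 𝒱) n → n ≥ 1 →
                   Decides Γ n (pending Γ n (allFin n)) [] (twoStageCompilation Γ n)
twoStage-decides Γ n@(suc _) _ = stageI-step Γ n zero (List.tabulate suc) (pending-unique Γ n) λ τ →
  stageI-decides Γ n (List.tabulate suc) (proj₁ (proj₂ (unique-++⁻ (unaryAtoms zero) (pending-unique Γ n))))
    (typed-extend Γ n [] (λ e → inj₁ (∈-allFin e)))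

theorem9 : (𝒱 : Vocabulary) (Γ : ScottNormalForm 𝒱) (n : ℕ) → n ≥ 1 →
    IsDDNNF (twoStageCompilation Γ n) × twoStageCompilation Γ n Encodes grounding Γ n
theorem9 𝒱 Γ n n≥1 = ddnnf , λ v → mk⇔
  -- The witness agrees with `v` on every atom, so `v` inherits the truth of `Γ` from it.
  (λ p → let 𝒜 , 𝒜⊨Γ , _ , agree = sound p
         in from (grounding-⇔ Γ) (⊨ₛ-resp Γ (λ a → agree (pending-exhaustive Γ n a)) 𝒜⊨Γ))
  -- The argument left to inference proves the empty context, which is an empty conjunction.
  (λ p → complete (to (grounding-⇔ Γ) p) _)
  where open Decides (twoStage-decides Γ n n≥1)
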